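{- For $n\ge 1$ let $\tau$ be a recursive tree of size $n$ chosen uniformly at random, and let $X_n$ be the number of distinct shapes (Pólya trees) among the fringe subtrees of $\tau$, i.e. the size of the compacted tree of $\tau$. Then \[ \mathbb{E}(X_n) = \mathcal{O}\!\left(\frac{n}{\log n}\right) \quad \text{as } n\to\infty . \]
   Context: A recursive tree of size $n$ is a rooted non-plane (unordered) tree with $n$ nodes carrying the distinct labels $1,\dots,n$ such that labels increase along every path from the root to a leaf; there are $(n-1)!$ of them. A Pólya tree is an unlabeled rooted non-plane tree; the shape of a (labeled) tree is the Pólya tree obtained by forgetting its labels. A fringe subtree of a rooted tree is a node together with all of its descendants. The compacted tree keeps one copy of each distinct fringe-subtree shape, so its size is the number of distinct fringe-subtree shapes. -}

module Defs where

open import Data.Empty using (⊥-elim)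
open import Data.Fin.Base as Fin using (Fin; zero; suc; toℕ; fromℕ; fromℕ<; inject₁)
import Data.Fin.Induction as Finᵢ
import Data.Fin.Properties as Finₚ
open import Data.Fin.Relation.Unary.Top using (view; ‵fromℕ; ‵inj₁)
open import Data.Integer.Base using (+_)
open import Data.List.Base as List using (List; []; _∷_; length; filter; allFin; deduplicate; cartesianProductWith)
import Data.List.Properties as Listₚ
open import Data.List.Membership.Propositional using (_∈_)
open import Data.List.Membership.Propositional.Properties using (∈-allFin; ∈-cartesianProductWith⁺; ∈-cartesianProductWith⁻)
open import Data.List.Relation.Binary.Permutation.Homogeneous using (Permutation; refl; prep; swap; trans)
import Data.List.Relation.Binary.Permutation.Setoid as PermSetoid
import Data.List.Relation.Binary.Permutation.Setoid.Properties as PermSetoidₚ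
open import Data.List.Relation.Binary.Pointwise.Base using (Pointwise; []; _∷_)
import Data.List.Relation.Unary.All as All
import Data.List.Relation.Unary.All.Properties as Allₚ
open import Data.List.Relation.Unary.Any as Any using (Any; here; there; any?; _─_)
import Data.List.Relation.Unary.AllPairs as AllPairs
open import Data.List.Relation.Unary.Unique.Propositional using (Unique)
import Data.List.Relation.Unary.Unique.Propositional.Properties as Uniqueₚ
open import Data.Maybe.Base as Maybe using (Maybe; just; nothing)
import Data.Maybe.Properties as Maybeₚ
open import Data.Nat.Base as ℕ using (ℕ; zero; suc; _!; NonZero)
import Data.Nat.ListAction as ℕ
import Data.Nat.Properties as ℕₚ
open import Data.Product.Base using (∃-syntax; _×_; _,_; proj₁; proj₂)
open import Data.Rational.Unnormalised as ℚ using (ℚᵘ; 0ℚᵘ; 1ℚᵘ)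
open import Data.Vec.Base as Vec using (Vec; []; _∷_; lookup; tabulate; _∷ʳ_; initLast)
import Data.Vec.Properties as Vecₚ
open import Function.Base using (_∘_)
open import Induction.WellFounded using (Acc; acc)
open import Level using (0ℓ)
open import Relation.Binary.Bundles using (Setoid)
open import Relation.Binary.Definitions using (Decidable)
open import Relation.Binary.PropositionalEquality as ≡ using (_≡_; refl; cong; cong₂; subst)
open import Relation.Nullary using (yes; no)

private
  variable
    n : ℕ

------------------------------------------------------------------------
-- Pólya trees

-- A Pólya tree is a `Tree` considered up to `_≅_`, which lets the list
-- of children be permuted at every node.

data Tree : Set where
  node : List Tree → Tree

infix 4 _≅_ _≅?_

data _≅_ : Tree → Tree → Set where
  node : ∀ {ts us} → Permutation _≅_ ts us → node ts ≅ node us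

mutual
  ≅-refl : ∀ {t} → t ≅ t
  ≅-refl {node ts} = node (refl (≅-refls ts))

  ≅-refls : ∀ ts → Pointwise _≅_ ts ts
  ≅-refls []       = []
  ≅-refls (t ∷ ts) = ≅-refl ∷ ≅-refls ts

mutual
  ≅-sym : ∀ {t u} → t ≅ u → u ≅ t
  ≅-sym (node p) = node (↭-sym p)

  ↭-sym : ∀ {ts us} → Permutation _≅_ ts us → Permutation _≅_ us ts
  ↭-sym (refl eqs)   = refl (≅-syms eqs)
  ↭-sym (prep e p)   = prep (≅-sym e) (↭-sym p)
  ↭-sym (swap e f p) = swap (≅-sym f) (≅-sym e) (↭-sym p)
  ↭-sym (trans p q)  = trans (↭-sym q) (↭-sym p)

  ≅-syms : ∀ {ts us} → Pointwise _≅_ ts us → Pointwise _≅_ us ts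
  ≅-syms []       = []
  ≅-syms (e ∷ es) = ≅-sym e ∷ ≅-syms es

≅-trans : ∀ {t u v} → t ≅ u → u ≅ v → t ≅ v
≅-trans (node p) (node q) = node (trans p q)

polyaSetoid : Setoid 0ℓ 0ℓ
polyaSetoid = record
  { Carrier       = Tree
  ; _≈_           = _≅_
  ; isEquivalence = record { refl = ≅-refl ; sym = ≅-sym ; trans = ≅-trans }
  }

private
  module P = PermSetoid polyaSetoid
  module Pₚ = PermSetoidₚ polyaSetoid

  extract : ∀ {t us} (i : Any (t ≅_) us) → us P.↭ t ∷ (us ─ i)
  extract (here t≅u)            = prep (≅-sym t≅u) P.↭-refl
  extract (there {x = u} i)     = trans (prep ≅-refl (extract i)) (swap ≅-refl ≅-refl P.↭-refl)

mutual
  _≅?_ : Decidable _≅_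
  node ts ≅? node us with ts ↭? us
  ... | yes p = yes (node p)
  ... | no ¬p = no λ { (node p) → ¬p p }

  _↭?_ : Decidable (Permutation _≅_)
  []       ↭? []       = yes (refl [])
  []       ↭? (u ∷ us) = no (Pₚ.¬x∷xs↭[] ∘ ↭-sym)
  (t ∷ ts) ↭? us with any? (t ≅?_) us
  ... | no  t∉us = no λ p → t∉us (Pₚ.∈-resp-↭ p (here ≅-refl))
  ... | yes i with ts ↭? (us ─ i)
  ...   | yes p = yes (trans (prep ≅-refl p) (↭-sym (extract i)))
  ...   | no ¬p = no λ q → ¬p (Pₚ.drop-∷ (trans q (extract i)))

------------------------------------------------------------------------
-- Recursive trees

-- A rooted non-plane tree on n labelled nodes is given by the parent of
-- each node (`nothing` for the root). Node i : Fin n carries the label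
-- 1 + toℕ i.

ParentMap : ℕ → Set
ParentMap n = Vec (Maybe (Fin n)) n

data Ancestor (p : ParentMap n) (a : Fin n) : Fin n → Set where
  self : Ancestor p a a
  up   : ∀ {u v} → lookup p v ≡ just u → Ancestor p a u → Ancestor p a v

record IsRecursiveTree (p : ParentMap n) : Set where
  field
    root        : Fin n
    root-orphan : lookup p root ≡ nothing
    connected   : ∀ v → Ancestor p root v
    increasing  : ∀ {u v} → lookup p v ≡ just u → u Fin.< v

------------------------------------------------------------------------
-- Fringe subtrees and compaction

children : ParentMap n → Fin n → List (Fin n)
children {n} p v = filter (λ u → Maybeₚ.≡-dec Finₚ._≟_ (lookup p u) (just v)) (allFin n)

shapeToDepth : ℕ → ParentMap n → Fin n → Tree
shapeToDepth zero    p v = node []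
shapeToDepth (suc d) p v = node (List.map (shapeToDepth d p) (children p v))

-- The shape of the fringe subtree at v. Cutting at depth n loses nothing
-- in a recursive tree of size n: see `fringeShape-unfold`.
fringeShape : ParentMap n → Fin n → Tree
fringeShape {n} = shapeToDepth n

compactedSize : ParentMap n → ℕ
compactedSize {n} p = length (deduplicate _≅?_ (List.map (fringeShape p) (allFin n)))

private
  shapeToDepth-stable : ∀ {p : ParentMap n} → IsRecursiveTree p →
                        ∀ d v → n ℕ.≤ toℕ v ℕ.+ d →
                        shapeToDepth d p v ≡ shapeToDepth (suc d) p v
  shapeToDepth-stable _ zero v n≤v+0 =
    ⊥-elim (ℕₚ.<⇒≱ (Finₚ.toℕ<n v) (subst (_ ℕ.≤_) (ℕₚ.+-identityʳ _) n≤v+0))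
  shapeToDepth-stable {n} {p} rec (suc d) v n≤v+1+d =
    cong node (Listₚ.map-cong-local (All.map step (Allₚ.all-filter _ (allFin n))))
    where
    step : ∀ {u} → lookup p u ≡ just v → shapeToDepth d p u ≡ shapeToDepth (suc d) p u
    step {u} pu≡v = shapeToDepth-stable rec d u (ℕₚ.≤-trans n≤v+1+d
      (ℕₚ.≤-trans (ℕₚ.≤-reflexive (ℕₚ.+-suc (toℕ v) d))
                  (ℕₚ.+-monoˡ-≤ d (IsRecursiveTree.increasing rec pu≡v))))

fringeShape-unfold : ∀ {p : ParentMap n} → IsRecursiveTree p → ∀ v →
                     fringeShape p v ≡ node (List.map (fringeShape p) (children p v))
fringeShape-unfold {n} rec v = shapeToDepth-stable rec n v (ℕₚ.m≤n+m n (toℕ v))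

------------------------------------------------------------------------
-- Enumeration of the recursive trees of size n

record Enumeration {A : Set} (P : A → Set) : Set where
  field
    elements : List A
    unique   : Unique elements
    sound    : ∀ {x} → x ∈ elements → P x
    complete : ∀ {x} → P x → x ∈ elements

open Enumeration public using (elements)

-- Adds a new largest label as a child of v.
attach : ParentMap n → Fin n → ParentMap (suc n)
attach p v = Vec.map (Maybe.map inject₁) p ∷ʳ just (inject₁ v)

recursiveTreeList : ∀ n → List (ParentMap n)
recursiveTreeList 0             = []
recursiveTreeList 1             = (nothing ∷ []) ∷ []
recursiveTreeList (suc (suc m)) =
  cartesianProductWith attach (recursiveTreeList (suc m)) (allFin (suc m))

length-recursiveTreeList : ∀ m → length (recursiveTreeList (suc m)) ≡ m !
length-recursiveTreeList zero    = refl
length-recursiveTreeList (suc m) = begin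
  length (cartesianProductWith attach ts vs) ≡⟨ length-product ts ⟩
  length ts ℕ.* length vs                    ≡⟨ cong₂ ℕ._*_ (length-recursiveTreeList m) (Listₚ.length-tabulate {n = suc m} (λ i → i)) ⟩
  m ! ℕ.* suc m                              ≡⟨ ℕₚ.*-comm (m !) (suc m) ⟩
  suc m ℕ.* m !                              ∎
  where
  open ≡.≡-Reasoning
  ts = recursiveTreeList (suc m)
  vs = allFin (suc m)

  length-product : ∀ ps → length (cartesianProductWith attach ps vs) ≡ length ps ℕ.* length vs
  length-product []       = refl
  length-product (p ∷ ps) = ≡.trans (Listₚ.length-++ (List.map (attach p) vs))
    (cong₂ ℕ._+_ (Listₚ.length-map (attach p) vs) (length-product ps))

private
  ParentOK : Fin n → Maybe (Fin n) → Set
  ParentOK v nothing  = toℕ v ≡ 0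
  ParentOK v (just u) = u Fin.< v

  AllOK : ParentMap n → Set
  AllOK p = ∀ v → ParentOK v (lookup p v)

  recursive⇒ok : ∀ {p : ParentMap n} → IsRecursiveTree p → AllOK p
  recursive⇒ok {suc n} {p} rec v with lookup p v in pv
  ... | just u  = IsRecursiveTree.increasing rec pv
  ... | nothing = cong toℕ (≡.trans (isRoot v pv) (≡.sym (isRoot zero p0)))
    where
    open IsRecursiveTree rec
    isRoot : ∀ w → lookup p w ≡ nothing → w ≡ root
    isRoot w pw with connected w
    ... | self = refl
    ... | up pw′ _ with ≡.trans (≡.sym pw) pw′
    ...   | ()
    p0 : lookup p zero ≡ nothing
    p0 with lookup p zero in eq
    ... | nothing = refl
    ... | just u with increasing eq
    ...   | ()

  ok⇒recursive : ∀ {p : ParentMap (suc n)} → AllOK p → IsRecursiveTree p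
  ok⇒recursive {n} {p} ok = record
    { root        = zero
    ; root-orphan = orphan
    ; connected   = λ v → connect v (Finᵢ.<-wellFounded v)
    ; increasing  = incr
    }
    where
    orphan : lookup p zero ≡ nothing
    orphan with lookup p zero | ok zero
    ... | nothing | _ = refl

    incr : ∀ {u v} → lookup p v ≡ just u → u Fin.< v
    incr {u} {v} eq = subst (ParentOK v) eq (ok v)

    connect : ∀ v → Acc Fin._<_ v → Ancestor p zero v
    connect v (acc rs) with lookup p v in eq
    ... | just u  = up eq (connect u (rs (incr eq)))
    ... | nothing with v | subst (ParentOK v) eq (ok v)
    ...   | zero | _ = self

  lookup-init : ∀ {A : Set} (xs : Vec A n) x i → lookup (xs ∷ʳ x) (inject₁ i) ≡ lookup xs i
  lookup-init (y ∷ xs) x zero    = refl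
  lookup-init (y ∷ xs) x (suc i) = lookup-init xs x i

  lookup-last : ∀ {A : Set} (xs : Vec A n) x → lookup (xs ∷ʳ x) (fromℕ n) ≡ x
  lookup-last []       x = refl
  lookup-last (y ∷ xs) x = lookup-last xs x

  ok-inject : ∀ (v : Fin n) x → ParentOK v x → ParentOK (inject₁ v) (Maybe.map inject₁ x)
  ok-inject v nothing  ok = ≡.trans (Finₚ.toℕ-inject₁ v) ok
  ok-inject v (just u) ok =
    ≡.subst₂ ℕ._<_ (≡.sym (Finₚ.toℕ-inject₁ u)) (≡.sym (Finₚ.toℕ-inject₁ v)) ok

  lower : ∀ (u : Fin (suc n)) → toℕ u ℕ.< n → ∃[ w ] u ≡ inject₁ w
  lower u u<n = fromℕ< u<n , Finₚ.toℕ-injective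
    (≡.sym (≡.trans (Finₚ.toℕ-inject₁ _) (Finₚ.toℕ-fromℕ< u<n)))

  ok-lower : ∀ (v : Fin n) x → ParentOK (inject₁ v) x →
             ∃[ y ] x ≡ Maybe.map inject₁ y × ParentOK v y
  ok-lower v nothing  ok = nothing , refl , ≡.trans (≡.sym (Finₚ.toℕ-inject₁ v)) ok
  ok-lower v (just u) ok with subst (toℕ u ℕ.<_) (Finₚ.toℕ-inject₁ v) ok
  ... | u<v with lower u (ℕₚ.<-trans u<v (Finₚ.toℕ<n v))
  ...   | w , refl = just w , refl , subst (ℕ._< toℕ v) (Finₚ.toℕ-inject₁ w) u<v

  ok-attach : ∀ (p : ParentMap n) w → AllOK p → AllOK (attach p w)
  ok-attach {n} p w ok v with view v
  ... | ‵fromℕ rewrite lookup-last (Vec.map (Maybe.map inject₁) p) (just (inject₁ w)) =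
    ≡.subst₂ ℕ._<_ (≡.sym (Finₚ.toℕ-inject₁ w)) (≡.sym (Finₚ.toℕ-fromℕ n)) (Finₚ.toℕ<n w)
  ... | ‵inj₁ {i = i} _
    rewrite lookup-init (Vec.map (Maybe.map inject₁) p) (just (inject₁ w)) i
          | Vecₚ.lookup-map i (Maybe.map inject₁) p = ok-inject i (lookup p i) (ok i)

  ok-detach : ∀ (p : ParentMap (suc (suc n))) → AllOK p →
              ∃[ q ] ∃[ w ] p ≡ attach q w × AllOK q
  ok-detach {n} p ok with initLast p
  ... | xs , x , refl = go x (subst (ParentOK (fromℕ (suc n))) (lookup-last xs x) (ok _))
    where
    lowered : ∀ i → ∃[ y ] lookup xs i ≡ Maybe.map inject₁ y × ParentOK i y
    lowered i = ok-lower i (lookup xs i) (subst (ParentOK (inject₁ i)) (lookup-init xs x i) (ok (inject₁ i)))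

    q : ParentMap (suc n)
    q = tabulate (proj₁ ∘ lowered)

    xs≡ : xs ≡ Vec.map (Maybe.map inject₁) q
    xs≡ = begin
      xs                                                   ≡⟨ Vecₚ.tabulate∘lookup xs ⟨
      tabulate (lookup xs)                                 ≡⟨ Vecₚ.tabulate-cong (proj₁ ∘ proj₂ ∘ lowered) ⟩
      tabulate (Maybe.map inject₁ ∘ proj₁ ∘ lowered)       ≡⟨ Vecₚ.tabulate-∘ (Maybe.map inject₁) (proj₁ ∘ lowered) ⟩
      Vec.map (Maybe.map inject₁) q                        ∎
      where open ≡.≡-Reasoning

    okq : AllOK q
    okq i = subst (ParentOK i) (≡.sym (Vecₚ.lookup∘tabulate (proj₁ ∘ lowered) i)) (proj₂ (proj₂ (lowered i)))

    go : ∀ y → ParentOK (fromℕ (suc n)) y → ∃[ q ] ∃[ w ] xs ∷ʳ y ≡ attach q w × AllOK q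
    go (just u) u<last with lower u (subst (toℕ u ℕ.<_) (Finₚ.toℕ-fromℕ (suc n)) u<last)
    ... | w , refl = q , w , cong (_∷ʳ just (inject₁ w)) xs≡ , okq

  map-injective : ∀ {m} (xs ys : Vec (Maybe (Fin n)) m) →
                  Vec.map (Maybe.map inject₁) xs ≡ Vec.map (Maybe.map inject₁) ys → xs ≡ ys
  map-injective []       []       _  = refl
  map-injective (x ∷ xs) (y ∷ ys) eq with Vecₚ.∷-injective eq
  ... | x≡y , xs≡ys =
    cong₂ _∷_ (Maybeₚ.map-injective Finₚ.inject₁-injective x≡y) (map-injective xs ys xs≡ys)

  attach-injective : ∀ {p q : ParentMap n} {v w} → attach p v ≡ attach q w → p ≡ q × v ≡ w
  attach-injective {p = p} {q} eq with Vecₚ.∷ʳ-injective (Vec.map _ p) (Vec.map _ q) eq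
  ... | ps≡qs , v≡w =
    map-injective p q ps≡qs ,
    Finₚ.inject₁-injective (Maybeₚ.just-injective v≡w)

  list-unique : ∀ n → Unique (recursiveTreeList n)
  list-unique 0             = AllPairs.[]
  list-unique 1             = All.[] AllPairs.∷ AllPairs.[]
  list-unique (suc (suc m)) =
    Uniqueₚ.cartesianProductWith⁺ attach attach-injective (list-unique (suc m)) (Uniqueₚ.allFin⁺ (suc m))

  list-sound : ∀ n {p} → p ∈ recursiveTreeList (suc n) → AllOK p
  list-sound zero    (here refl) zero = refl
  list-sound (suc m) p∈ with ∈-cartesianProductWith⁻ attach (recursiveTreeList (suc m)) (allFin (suc m)) p∈
  ... | q , w , q∈ , _ , refl = ok-attach q w (list-sound m q∈)

  list-complete : ∀ n {p} → AllOK p → p ∈ recursiveTreeList (suc n)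
  list-complete zero    {nothing ∷ []} ok = here refl
  list-complete zero    {just zero ∷ []} ok with ok zero
  ... | ()
  list-complete (suc m) {p} ok with ok-detach p ok
  ... | q , w , refl , okq = ∈-cartesianProductWith⁺ attach (list-complete m okq) (∈-allFin w)

recursiveTrees : ∀ n → Enumeration (IsRecursiveTree {n})
recursiveTrees n = record
  { elements = recursiveTreeList n
  ; unique   = list-unique n
  ; sound    = sound n
  ; complete = complete n
  }
  where
  sound : ∀ n {p} → p ∈ recursiveTreeList n → IsRecursiveTree p
  sound (suc n) p∈ = ok⇒recursive (list-sound n p∈)

  complete : ∀ n {p} → IsRecursiveTree p → p ∈ recursiveTreeList n
  complete zero    rec with IsRecursiveTree.root rec
  ... | ()
  complete (suc n) rec = list-complete n (recursive⇒ok rec)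

recursiveTrees-nonempty : ∀ n .{{_ : NonZero n}} → NonZero (length (elements (recursiveTrees n)))
recursiveTrees-nonempty (suc m) =
  subst NonZero (≡.sym (length-recursiveTreeList m)) (m ℕₚ.!≢0)

------------------------------------------------------------------------
-- Expectation under the uniform distribution

uniformMean : ∀ {A : Set} {P : A → Set} (e : Enumeration P) .{{_ : NonZero (length (elements e))}} →
              (A → ℕ) → ℚᵘ
uniformMean e f = + ℕ.sum (List.map f (elements e)) ℚ./ length (elements e)

𝔼[X_] : ∀ n .{{_ : NonZero n}} → ℚᵘ
𝔼[X n ] = uniformMean (recursiveTrees n) {{recursiveTrees-nonempty n}} compactedSize

------------------------------------------------------------------------
-- The natural logarithm

-- expTerm k q = qᵏ / k!  and  expSum k q = Σ_{i ≤ k} qⁱ / i!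

expTerm : ℕ → ℚᵘ → ℚᵘ
expTerm zero    q = 1ℚᵘ
expTerm (suc k) q = expTerm k q ℚ.* q ℚ.* (+ 1 ℚ./ suc k)

expSum : ℕ → ℚᵘ → ℚᵘ
expSum zero    q = expTerm zero q
expSum (suc k) q = expSum k q ℚ.+ expTerm (suc k) q

-- For n ≥ 1 and rational q, q ≤ln n holds iff 0 ≤ q ≤ ln n: for q ≥ 0 the
-- partial sums increase to exp q, so they are all ≤ n iff exp q ≤ n.
-- As ln n is the supremum of these q, a rational inequality x * ln n ≤ y
-- with x ≥ 0 is the statement that x * q ≤ y for every q ≤ln n.
infix 4 _≤ln_

_≤ln_ : ℚᵘ → ℕ → Set
q ≤ln n = 0ℚᵘ ℚ.≤ q × (∀ k → expSum k q ℚ.≤ + n ℚ./ 1)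

{-# OPTIONS --safe #-}

-- Call a fringe subtree big if its size is at least k. The small ones have
-- at most 4 ^ k shapes, so X_n is at most the number of big fringe subtrees
-- plus 4 ^ k. Attaching label n + 1 to a uniformly random node enlarges a
-- fringe subtree of size j with probability j / n, and this recurrence shows
-- that the expected number of big fringe subtrees is at most n / k. Hence
-- k E(X_n) ≤ n + k 4 ^ k ≤ 2 n for the largest k with 8 ^ k ≤ n, and this k is
-- of order log n.

module Submission where

open import Defs
open import Data.Bool.Base using (Bool; true; false; if_then_else_)
open import Data.Fin.Base as Fin using (Fin; zero; suc; fromℕ<; fromℕ; inject₁)
import Data.Fin.Induction as Finᵢ
import Data.Fin.Properties as Finₚ
open import Data.Fin.Relation.Unary.Top using (view; ‵fromℕ; ‵inject₁)
import Data.Integer.Base as ℤ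
import Data.Integer.Properties as ℤₚ
open import Data.List.Base as List using (List; []; _∷_; _++_; length; filter; allFin;
  deduplicate; cartesianProductWith)
import Data.List.Properties as Listₚ
open import Data.List.Membership.Propositional using (_∈_)
open import Data.List.Membership.Propositional.Properties
  using (∈-allFin; ∈-lookup; ∈-cartesianProductWith⁺; ∈-cartesianProductWith⁻)
open import Data.List.Relation.Binary.Sublist.Propositional using (_⊆_; []; _∷_; ⊆-trans)
import Data.List.Relation.Binary.Sublist.Propositional.Properties as Sublistₚ
open import Data.List.Relation.Unary.All as All using (All)
import Data.List.Relation.Unary.All.Properties as Allₚ
open import Data.List.Relation.Unary.AllPairs as AllPairs using (AllPairs; []; _∷_)
import Data.List.Relation.Unary.AllPairs.Properties as AllPairsₚ
open import Data.List.Relation.Unary.Any using (here; there)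
open import Data.List.Relation.Unary.Unique.Propositional using (Unique)
import Data.List.Relation.Unary.Unique.Propositional.Properties as Uniqueₚ
open import Data.Maybe.Base as Maybe using (just)
import Data.Maybe.Properties as Maybeₚ
open import Data.Nat.Base
open import Data.Nat.ListAction using () renaming (sum to sumₗ)
import Data.Nat.ListAction.Properties as ListActionₚ
open import Data.Nat.Properties
open import Data.Nat.Tactic.RingSolver using (solve-∀)
open import Data.Product.Base using (∃; _×_; _,_; proj₁)
open import Data.Rational.Unnormalised as ℚ using (ℚᵘ; *≤*)
import Data.Rational.Unnormalised.Properties as ℚₚ
open import Data.Sum.Base using (_⊎_; inj₁; inj₂)
open import Data.Vec.Base as Vec using (Vec; []; _∷_; lookup; _∷ʳ_)
import Data.Vec.Properties as Vecₚ
open import Function.Base using (_∘_; id)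
open import Function.Bundles using (_⇔_; mk⇔)
open import Induction.WellFounded using (Acc; acc)
open import Relation.Binary.PropositionalEquality
open import Relation.Nullary using (Dec; does; ¬_; yes; no; ¬?)
open import Relation.Nullary.Decidable using (does-⇔; dec-true; dec-false)
open import Relation.Nullary.Negation using (contradiction)
open import Algebra.Properties.Semiring.Sum +-*-semiring

-- Why the recurrence gives n / k: let B(n, j) be the expected number of fringe subtrees of size at
-- least j. Those of size exactly j number B(n, j) - B(n, j + 1), so n B(n + 1, j + 1) = (n - j)
-- B(n, j + 1) + j B(n, j). For j ≤ n both coefficients are nonnegative, so the bounds n / (j + 1)
-- and n / j can be inserted, and (n - j) / (j + 1) + 1 = (n + 1) / (j + 1) closes the induction.
--
-- To stay in ℕ, expectations are multiplied by the number (n - 1)! of trees, and rationals enter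
-- only in the last estimate.
--
-- The probability j / n rests on a double count: the nodes whose new child enlarges the subtree at
-- v are exactly the descendants of v. Descent is therefore kept as a 0/1 matrix that grows with
-- `attach`. Its entries are bounded by 1 by construction, and the recursion over children
-- identifies its row sums with the fringe sizes.
--
-- Shapes are counted through plane trees, which have a simple injective binary code. Choosing an
-- order of the children can only increase the count.

private variable
  n : ℕ
  X : Set

-- Encoding of trees

mutual
  size : Tree → ℕ
  size (node ts) = suc (sizes ts)

  sizes : List Tree → ℕ
  sizes []       = 0
  sizes (t ∷ ts) = size t + sizes ts

sizes-sum : ∀ ts → sizes ts ≡ sumₗ (List.map size ts)
sizes-sum []       = refl
sizes-sum (t ∷ ts) = cong (size t +_) (sizes-sum ts)

-- Appends the Dyck word of the forest, in reverse, to the binary digits of a.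
code : List Tree → ℕ → ℕ
code []             a = 2 * a
code (node ts ∷ us) a = suc (2 * code ts (code us a))

-- The last binary digit tells whether the forest is empty (0) or starts with a node (1), so
-- decoding never has to guess. Recovering the accumulator as well is what lets the induction pass
-- from the children of the first tree to its siblings, whose code is the accumulator.
code-injective : ∀ ts us {a b} → code ts a ≡ code us b → ts ≡ us × a ≡ b
code-injective []       []       eq = refl , *-cancelˡ-≡ _ _ 2 eq
code-injective []       (node us ∷ us′) {a} {b} eq = contradiction eq (even≢odd a (code us (code us′ b)))
code-injective (node ts ∷ ts′) [] {a} {b} eq = contradiction (sym eq) (even≢odd b (code ts (code ts′ a)))
code-injective (node ts ∷ ts′) (node us ∷ us′) eq
  with refl , eq′ ← code-injective ts us
    (*-cancelˡ-≡ (code ts (code ts′ _)) (code us (code us′ _)) 2 (suc-injective eq))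
  with refl , a≡b ← code-injective ts′ us′ eq′ = refl , a≡b

-- Each node costs two binary digits and the end of the forest one more, which gives the factor 2 *
-- 4 ^ sizes. The strict bound with `suc a` composes: it bounds the successor of one accumulator by
-- what the next call needs.
code-bound : ∀ ts a → code ts a < suc a * (2 * 4 ^ sizes ts)
code-bound []             a = begin-strict
  2 * a           <⟨ *-monoʳ-< 2 (n<1+n a) ⟩
  2 * suc a       ≡⟨ *-comm 2 (suc a) ⟩
  suc a * 2       ∎
  where open ≤-Reasoning
code-bound (node ts ∷ us) a = begin
  2 + 2 * code ts (code us a)                            ≡⟨ *-suc 2 _ ⟨
  2 * suc (code ts (code us a))
    ≤⟨ *-monoʳ-≤ 2 (code-bound ts (code us a)) ⟩
  2 * (suc (code us a) * (2 * 4 ^ sizes ts))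
    ≤⟨ *-monoʳ-≤ 2 (*-monoˡ-≤ _ (code-bound us a)) ⟩
  2 * (suc a * (2 * 4 ^ sizes us) * (2 * 4 ^ sizes ts))
    ≡⟨ regroup (suc a) (4 ^ sizes us) (4 ^ sizes ts) ⟩
  suc a * (2 * (4 * (4 ^ sizes ts * 4 ^ sizes us)))
    ≡⟨ cong (λ x → suc a * (2 * (4 * x))) (^-distribˡ-+-* 4 (sizes ts) (sizes us)) ⟨
  suc a * (2 * 4 ^ (suc (sizes ts) + sizes us))          ∎
  where
  open ≤-Reasoning
  regroup : ∀ a x y → 2 * (a * (2 * x) * (2 * y)) ≡ a * (2 * (4 * (y * x)))
  regroup = solve-∀

treeCode : Tree → ℕ
treeCode (node ts) = code ts 0

treeCode-injective : ∀ {t u} → treeCode t ≡ treeCode u → t ≡ u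
treeCode-injective {node ts} {node us} eq = cong node (proj₁ (code-injective ts us eq))

treeCode-bound : ∀ {t k} → size t < k → treeCode t < 4 ^ k
treeCode-bound {node ts} {k} t<k = begin-strict
  code ts 0                 <⟨ code-bound ts 0 ⟩
  1 * (2 * 4 ^ sizes ts)    ≡⟨ *-identityˡ _ ⟩
  2 * 4 ^ sizes ts          ≤⟨ *-monoˡ-≤ (4 ^ sizes ts) {2} {4} (s≤s (s≤s z≤n)) ⟩
  4 ^ size (node ts)        ≤⟨ ^-monoʳ-≤ 4 (<⇒≤ t<k) ⟩
  4 ^ k                     ∎
  where open ≤-Reasoning

lookup-injective : ∀ {A : Set} {xs : List A} → Unique xs →
  ∀ {i j} → List.lookup xs i ≡ List.lookup xs j → i ≡ j
lookup-injective (x∉xs ∷ xs!) {zero}  {zero}  _  = refl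
lookup-injective (x∉xs ∷ xs!) {zero}  {suc j} eq = contradiction eq (All.lookup x∉xs (∈-lookup j))
lookup-injective (x∉xs ∷ xs!) {suc i} {zero}  eq = contradiction (sym eq) (All.lookup x∉xs (∈-lookup i))
lookup-injective (x∉xs ∷ xs!) {suc i} {suc j} eq = cong suc (lookup-injective xs! eq)

unique⇒length≤ : ∀ {b} {ns : List ℕ} → Unique ns → All (_< b) ns → length ns ≤ b
unique⇒length≤ {b} {ns} ns! ns<b = Finₚ.injective⇒≤ {f = f} λ eq →
  lookup-injective ns! (Finₚ.fromℕ<-injective _ _ (bound _) (bound _) eq)
  where
  bound : ∀ i → List.lookup ns i < b
  bound i = All.lookup ns<b (∈-lookup i)

  f : Fin (length ns) → Fin b
  f i = fromℕ< (bound i)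

length-small : ∀ {k ts} → Unique ts → All (λ t → size t < k) ts → length ts ≤ 4 ^ k
length-small {k} {ts} ts! ts<k = begin
  length ts                     ≡⟨ Listₚ.length-map treeCode ts ⟨
  length (List.map treeCode ts)
    ≤⟨ unique⇒length≤ (Uniqueₚ.map⁺ treeCode-injective ts!) (Allₚ.map⁺ (All.map treeCode-bound ts<k)) ⟩
  4 ^ k                         ∎
  where open ≤-Reasoning

-- Splitting the distinct shapes at the threshold k

module _ {A : Set} {R : A → A → Set} (R? : ∀ x y → Dec (R x y)) where

  deduplicate-⊆ : ∀ xs → deduplicate R? xs ⊆ xs
  deduplicate-⊆ []       = []
  deduplicate-⊆ (x ∷ xs) = refl ∷ ⊆-trans
    (Sublistₚ.filter-⊆ (¬? ∘ R? x) (deduplicate R? xs))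
    (deduplicate-⊆ xs)

  deduplicate-apart : ∀ xs → AllPairs (λ x y → ¬ R x y) (deduplicate R? xs)
  deduplicate-apart []       = []
  deduplicate-apart (x ∷ xs) =
    Allₚ.all-filter _ (deduplicate R? xs) ∷ AllPairsₚ.filter⁺ _ (deduplicate-apart xs)

module _ {A : Set} {P : A → Set} (P? : ∀ x → Dec (P x)) where

  length-filter-split : ∀ xs → length xs ≡ length (filter P? xs) + length (filter (¬? ∘ P?) xs)
  length-filter-split []       = refl
  length-filter-split (x ∷ xs) with does (P? x)
  ... | true  = cong suc (length-filter-split xs)
  ... | false = trans (cong suc (length-filter-split xs)) (sym (+-suc _ _))

𝟙 : Bool → ℕ
𝟙 b = if b then 1 else 0

module _ {A : Set} {P : A → Set} (P? : ∀ x → Dec (P x)) where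

  length-filter-tabulate : ∀ {n} (f : Fin n → A) →
    length (filter P? (List.tabulate f)) ≡ ∑[ i < n ] 𝟙 (does (P? (f i)))
  length-filter-tabulate {zero}  f = refl
  length-filter-tabulate {suc n} f with does (P? (f zero))
  ... | true  = cong suc (length-filter-tabulate (f ∘ suc))
  ... | false = length-filter-tabulate (f ∘ suc)

  sum-map-filter-tabulate : ∀ {n} (f : Fin n → A) (g : A → ℕ) →
    sumₗ (List.map g (filter P? (List.tabulate f))) ≡ ∑[ i < n ] (𝟙 (does (P? (f i))) * g (f i))
  sum-map-filter-tabulate {zero}  f g = refl
  sum-map-filter-tabulate {suc n} f g with does (P? (f zero))
  ... | true  = cong₂ _+_ (sym (+-identityʳ _)) (sum-map-filter-tabulate (f ∘ suc) g)
  ... | false = sum-map-filter-tabulate (f ∘ suc) g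

module _ {n} (p : ParentMap n) where

  fringeSize : Fin n → ℕ
  fringeSize v = size (fringeShape p v)

  bigFringes : ℕ → ℕ
  bigFringes k = ∑[ v < n ] 𝟙 (does (k ≤? fringeSize v))

  compactedSize-bound : ∀ k → compactedSize p ≤ bigFringes k + 4 ^ k
  compactedSize-bound k = begin
    length shapes                                          ≡⟨ length-filter-split big? shapes ⟩
    length (filter big? shapes) + length (filter (¬? ∘ big?) shapes)
      ≤⟨ +-mono-≤ big-bound (length-small small-unique (All.map ≰⇒> (Allₚ.all-filter (¬? ∘ big?) shapes))) ⟩
    bigFringes k + 4 ^ k                                   ∎
    where
    open ≤-Reasoning
    fringes = List.map (fringeShape p) (allFin n)
    shapes = deduplicate _≅?_ fringes

    big? : ∀ t → Dec (k ≤ size t)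
    big? t = k ≤? size t

    -- Pairwise non-isomorphic trees are in particular pairwise distinct as plane trees, which is
    -- all that the code can detect.
    small-unique : Unique (filter (¬? ∘ big?) shapes)
    small-unique = AllPairsₚ.filter⁺ _
      (AllPairs.map (λ {t≇u refl → t≇u ≅-refl}) (deduplicate-apart _≅?_ fringes))

    -- Deduplication leaves a sublist of the list of fringe shapes, so every big shape is charged to
    -- a node of its own.
    big-bound : length (filter big? shapes) ≤ bigFringes k
    big-bound = begin
      length (filter big? shapes)
        ≤⟨ Sublistₚ.length-mono-≤ (Sublistₚ.filter⁺ big? big? (λ {refl → id}) (deduplicate-⊆ _≅?_ fringes)) ⟩
      length (filter big? fringes)
        ≡⟨ cong (length ∘ filter big?) (Listₚ.map-tabulate id (fringeShape p)) ⟩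
      length (filter big? (List.tabulate (fringeShape p)))
        ≡⟨ length-filter-tabulate big? (fringeShape p) ⟩
      bigFringes k                  ∎

-- Descendants

sum-const : ∀ n x → ∑[ i < n ] x ≡ n * x
sum-const zero    x = refl
sum-const (suc n) x = cong (x +_) (sum-const n x)

sum-const-≤ : ∀ {n b} {f : Fin n → ℕ} → (∀ i → f i ≤ b) → sum f ≤ n * b
sum-const-≤ {zero}  f≤b = z≤n
sum-const-≤ {suc n} f≤b = +-mono-≤ (f≤b zero) (sum-const-≤ (f≤b ∘ suc))

𝟙≤1 : ∀ b → 𝟙 b ≤ 1
𝟙≤1 true  = ≤-refl
𝟙≤1 false = z≤n

δ : Fin n → Fin n → ℕ
δ v u = 𝟙 (does (v Finₚ.≟ u))

δ-off : ∀ (v u : Fin n) → v ≢ u → δ v u ≡ 0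
δ-off v u v≢u = cong 𝟙 (dec-false (v Finₚ.≟ u) v≢u)

sum-δ : ∀ (v : Fin n) → ∑[ u < n ] δ v u ≡ 1
sum-δ {suc n} zero    = cong suc (trans (sum-const n 0) (*-zeroʳ n))
sum-δ {suc n} (suc v) = trans
  (sum-cong-≗ λ u → cong 𝟙
    (does-⇔ (mk⇔ Finₚ.suc-injective (cong suc)) (suc v Finₚ.≟ suc u) (v Finₚ.≟ u)))
  (sum-δ v)

-- The counterpart of `_∷ʳ_` for functions: it extends data on a tree to `fromℕ n`, the node that
-- `attach` adds.
snoc : (Fin n → X) → X → Fin (suc n) → X
snoc {zero}  f x _       = x
snoc {suc n} f x zero    = f zero
snoc {suc n} f x (suc i) = snoc (f ∘ suc) x i

snoc-inject₁ : ∀ (f : Fin n → X) x i → snoc f x (inject₁ i) ≡ f i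
snoc-inject₁ f x zero    = refl
snoc-inject₁ f x (suc i) = snoc-inject₁ (f ∘ suc) x i

snoc-fromℕ : ∀ (f : Fin n → X) x → snoc f x (fromℕ n) ≡ x
snoc-fromℕ {zero}  f x = refl
snoc-fromℕ {suc n} f x = snoc-fromℕ (f ∘ suc) x

lookup-∷ʳ-inject₁ : ∀ (xs : Vec X n) x i → lookup (xs ∷ʳ x) (inject₁ i) ≡ lookup xs i
lookup-∷ʳ-inject₁ (y ∷ xs) x zero    = refl
lookup-∷ʳ-inject₁ (y ∷ xs) x (suc i) = lookup-∷ʳ-inject₁ xs x i

lookup-∷ʳ-fromℕ : ∀ (xs : Vec X n) x → lookup (xs ∷ʳ x) (fromℕ n) ≡ x
lookup-∷ʳ-fromℕ []       x = refl
lookup-∷ʳ-fromℕ (y ∷ xs) x = lookup-∷ʳ-fromℕ xs x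

childOf? : ∀ (p : ParentMap n) v c → Dec (lookup p c ≡ just v)
childOf? p v c = Maybeₚ.≡-dec Finₚ._≟_ (lookup p c) (just v)

-- Indicator weights over all nodes, instead of a list of children, make exchange of summation and
-- distributivity directly applicable. Fringe sizes and descent both solve equations of the form f v
-- = g v + `childSum p f v`.
childSum : ParentMap n → (Fin n → ℕ) → Fin n → ℕ
childSum {n} p f v = ∑[ c < n ] (𝟙 (does (childOf? p v c)) * f c)

childSum-sum : ∀ {m} (p : ParentMap n) (f : Fin n → Fin m → ℕ) v →
  ∑[ u < m ] childSum p (λ c → f c u) v ≡ childSum p (λ c → ∑[ u < m ] f c u) v
childSum-sum p f v = trans (∑-comm (λ u c → 𝟙 (does (childOf? p v c)) * f c u))
  (sum-cong-≗ λ c → sym (*-distribˡ-sum (𝟙 (does (childOf? p v c))) (f c)))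

childSum-+ : ∀ (p : ParentMap n) f g v →
  childSum p (λ c → f c + g c) v ≡ childSum p f v + childSum p g v
childSum-+ p f g v = trans (sum-cong-≗ λ c → *-distribˡ-+ (𝟙 (does (childOf? p v c))) (f c) (g c))
  (∑-distrib-+ (λ c → 𝟙 (does (childOf? p v c)) * f c) _)

childSum-cong : ∀ (p : ParentMap n) {f g} v → (∀ c → lookup p c ≡ just v → f c ≡ g c) →
  childSum p f v ≡ childSum p g v
childSum-cong p {f} {g} v f≗g = sum-cong-≗ step
  where
  step : ∀ c → 𝟙 (does (childOf? p v c)) * f c ≡ 𝟙 (does (childOf? p v c)) * g c
  step c with childOf? p v c
  ... | yes pc≡v = cong (1 *_) (f≗g c pc≡v)
  ... | no  _    = refl

-- Children carry larger labels, so the recursion ends at the leaves.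
childSum-unique : ∀ {p : ParentMap n} → IsRecursiveTree p → ∀ (g : Fin n → ℕ) {f f′} →
  (∀ v → f v ≡ g v + childSum p f v) → (∀ v → f′ v ≡ g v + childSum p f′ v) → ∀ v → f v ≡ f′ v
childSum-unique {n} {p} rec g {f} {f′} f-unfold f′-unfold v = go v (Finᵢ.>-wellFounded v)
  where
  go : ∀ v → Acc Fin._>_ v → f v ≡ f′ v
  go v (acc rs) = begin
    f v                   ≡⟨ f-unfold v ⟩
    g v + childSum p f v
      ≡⟨ cong (g v +_) (childSum-cong p v λ c pc≡v → go c (rs (IsRecursiveTree.increasing rec pc≡v))) ⟩
    g v + childSum p f′ v ≡⟨ f′-unfold v ⟨
    f′ v                  ∎
    where open ≡-Reasoning

fringeSize-unfold : ∀ {p : ParentMap n} → IsRecursiveTree p → ∀ v →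
  fringeSize p v ≡ 1 + childSum p (fringeSize p) v
fringeSize-unfold {n} {p} rec v = begin
  size (fringeShape p v)
    ≡⟨ cong size (fringeShape-unfold rec v) ⟩
  suc (sizes (List.map (fringeShape p) (children p v)))
    ≡⟨ cong suc (sizes-sum (List.map (fringeShape p) (children p v))) ⟩
  suc (sumₗ (List.map size (List.map (fringeShape p) (children p v))))
    ≡⟨ cong (suc ∘ sumₗ) (Listₚ.map-∘ (children p v)) ⟨
  suc (sumₗ (List.map (fringeSize p) (children p v)))
    ≡⟨ cong suc (sum-map-filter-tabulate (childOf? p v) id (fringeSize p)) ⟩
  suc (childSum p (fringeSize p) v)                                    ∎
  where open ≡-Reasoning

module _ (p : ParentMap n) (w : Fin n) where

  private p′ = attach p w

  lookup-attach-inject₁ : ∀ c → lookup p′ (inject₁ c) ≡ Maybe.map inject₁ (lookup p c)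
  lookup-attach-inject₁ c = trans
    (lookup-∷ʳ-inject₁ (Vec.map (Maybe.map inject₁) p) _ c)
    (Vecₚ.lookup-map c _ p)

  lookup-attach-fromℕ : lookup p′ (fromℕ n) ≡ just (inject₁ w)
  lookup-attach-fromℕ = lookup-∷ʳ-fromℕ (Vec.map (Maybe.map inject₁) p) _

  childSum-attach-inject₁ : ∀ f v →
    childSum p′ f (inject₁ v) ≡ childSum p (f ∘ inject₁) v + δ v w * f (fromℕ n)
  childSum-attach-inject₁ f v = begin
    childSum p′ f (inject₁ v)
      ≡⟨ sum-init-last (λ c → 𝟙 (does (childOf? p′ (inject₁ v) c)) * f c) ⟩
    ∑[ c < n ] (𝟙 (does (childOf? p′ (inject₁ v) (inject₁ c))) * f (inject₁ c))
      + 𝟙 (does (childOf? p′ (inject₁ v) (fromℕ n))) * f (fromℕ n)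
      ≡⟨ cong₂ _+_
           (sum-cong-≗ λ c → cong (λ b → 𝟙 b * f (inject₁ c))
             (does-⇔ (old c) (childOf? p′ (inject₁ v) (inject₁ c)) (childOf? p v c)))
           (cong (λ b → 𝟙 b * f (fromℕ n))
             (does-⇔ new (childOf? p′ (inject₁ v) (fromℕ n)) (v Finₚ.≟ w))) ⟩
    childSum p (f ∘ inject₁) v + δ v w * f (fromℕ n) ∎
    where
    open ≡-Reasoning
    old : ∀ c → (lookup p′ (inject₁ c) ≡ just (inject₁ v)) ⇔ (lookup p c ≡ just v)
    old c = mk⇔ (λ eq → Maybeₚ.map-injective Finₚ.inject₁-injective
                          (trans (sym (lookup-attach-inject₁ c)) eq))
                (λ eq → trans (lookup-attach-inject₁ c) (cong (Maybe.map inject₁) eq))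

    new : (lookup p′ (fromℕ n) ≡ just (inject₁ v)) ⇔ (v ≡ w)
    new = mk⇔ (λ eq → Finₚ.inject₁-injective (Maybeₚ.just-injective (trans (sym eq) lookup-attach-fromℕ)))
              (λ {refl → lookup-attach-fromℕ})

  childSum-attach-fromℕ : ∀ f → childSum p′ f (fromℕ n) ≡ 0
  childSum-attach-fromℕ f = begin
    childSum p′ f (fromℕ n)
      ≡⟨ sum-cong-≗ (λ c → cong (λ b → 𝟙 b * f c) (dec-false (childOf? p′ (fromℕ n) c) (leaf c))) ⟩
    ∑[ c < suc n ] 0            ≡⟨ sum-const (suc n) 0 ⟩
    suc n * 0                   ≡⟨ *-zeroʳ (suc n) ⟩
    0                           ∎
    where
    open ≡-Reasoning
    leaf : ∀ c → lookup p′ c ≢ just (fromℕ n)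
    leaf c eq with view c
    ... | ‵fromℕ = Finₚ.fromℕ≢inject₁ (Maybeₚ.just-injective (trans (sym eq) lookup-attach-fromℕ))
    ... | ‵inject₁ c with lookup p c | trans (sym (lookup-attach-inject₁ c)) eq
    ...   | just u | e = Finₚ.fromℕ≢inject₁ (sym (Maybeₚ.just-injective e))

-- `descendant v u` is 1 or 0 according as u lies in the fringe subtree at v.
record Descendants (p : ParentMap n) : Set where
  field
    descendant        : Fin n → Fin n → ℕ
    descendant≤1      : ∀ v u → descendant v u ≤ 1
    descendant-unfold : ∀ v u → descendant v u ≡ δ v u + childSum p (λ c → descendant c u) v

-- Apart from itself, the new node has as ancestors exactly those of `w`, with `w` included. So its
-- column repeats the column of `w`, and its row vanishes off the diagonal because it is a leaf.
descendants-attach : ∀ {p : ParentMap n} → Descendants p → ∀ w → Descendants (attach p w)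
descendants-attach {n} {p} desc w = record
  { descendant        = D
  ; descendant≤1      = D≤1
  ; descendant-unfold = D-unfold
  }
  where
  open Descendants desc
  open ≡-Reasoning

  oldRow : Fin n → Fin (suc n) → ℕ
  oldRow v = snoc (descendant v) (descendant v w)

  newRow : Fin (suc n) → ℕ
  newRow = snoc (λ _ → 0) 1

  D : Fin (suc n) → Fin (suc n) → ℕ
  D = snoc oldRow newRow

  D-old-old : ∀ v u → D (inject₁ v) (inject₁ u) ≡ descendant v u
  D-old-old v u = trans (cong (λ row → row (inject₁ u)) (snoc-inject₁ oldRow newRow v))
                        (snoc-inject₁ (descendant v) (descendant v w) u)

  D-old-new : ∀ v → D (inject₁ v) (fromℕ n) ≡ descendant v w
  D-old-new v = trans (cong (λ row → row (fromℕ n)) (snoc-inject₁ oldRow newRow v))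
                      (snoc-fromℕ (descendant v) (descendant v w))

  D-new-old : ∀ u → D (fromℕ n) (inject₁ u) ≡ 0
  D-new-old u = trans (cong (λ row → row (inject₁ u)) (snoc-fromℕ oldRow newRow))
                      (snoc-inject₁ (λ _ → 0) 1 u)

  D-new-new : D (fromℕ n) (fromℕ n) ≡ 1
  D-new-new = trans (cong (λ row → row (fromℕ n)) (snoc-fromℕ oldRow newRow))
                    (snoc-fromℕ {n} (λ _ → 0) 1)

  D≤1 : ∀ v u → D v u ≤ 1
  D≤1 v u with view v | view u
  ... | ‵inject₁ v | ‵inject₁ u = ≤-trans (≤-reflexive (D-old-old v u)) (descendant≤1 v u)
  ... | ‵inject₁ v | ‵fromℕ     = ≤-trans (≤-reflexive (D-old-new v)) (descendant≤1 v w)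
  ... | ‵fromℕ     | ‵inject₁ u = ≤-trans (≤-reflexive (D-new-old u)) z≤n
  ... | ‵fromℕ     | ‵fromℕ     = ≤-reflexive D-new-new

  δ-inject₁ : ∀ v u → δ (inject₁ v) (inject₁ u) ≡ δ v u
  δ-inject₁ v u = cong 𝟙
    (does-⇔ (mk⇔ Finₚ.inject₁-injective (cong inject₁)) (inject₁ v Finₚ.≟ inject₁ u) (v Finₚ.≟ u))

  D-unfold : ∀ v u → D v u ≡ δ v u + childSum (attach p w) (λ c → D c u) v
  D-unfold v u with view v | view u
  ... | ‵inject₁ v | ‵inject₁ u = begin
    D (inject₁ v) (inject₁ u)                           ≡⟨ D-old-old v u ⟩
    descendant v u                                      ≡⟨ descendant-unfold v u ⟩
    δ v u + childSum p (λ c → descendant c u) v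
      ≡⟨ cong₂ _+_ (δ-inject₁ v u) (childSum-cong p v λ c _ → D-old-old c u) ⟨
    δ (inject₁ v) (inject₁ u) + childSum p (λ c → D (inject₁ c) (inject₁ u)) v
      ≡⟨ cong (δ (inject₁ v) (inject₁ u) +_) (trans
           (cong (childSum p (λ c → D (inject₁ c) (inject₁ u)) v +_)
             (trans (cong (δ v w *_) (D-new-old u)) (*-zeroʳ (δ v w))))
           (+-identityʳ _)) ⟨
    δ (inject₁ v) (inject₁ u)
      + (childSum p (λ c → D (inject₁ c) (inject₁ u)) v + δ v w * D (fromℕ n) (inject₁ u))
      ≡⟨ cong (δ (inject₁ v) (inject₁ u) +_) (childSum-attach-inject₁ p w (λ c → D c (inject₁ u)) v) ⟨
    δ (inject₁ v) (inject₁ u) + childSum (attach p w) (λ c → D c (inject₁ u)) (inject₁ v) ∎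
  ... | ‵inject₁ v | ‵fromℕ     = begin
    D (inject₁ v) (fromℕ n)                             ≡⟨ D-old-new v ⟩
    descendant v w                                      ≡⟨ descendant-unfold v w ⟩
    δ v w + childSum p (λ c → descendant c w) v         ≡⟨ +-comm (δ v w) _ ⟩
    childSum p (λ c → descendant c w) v + δ v w
      ≡⟨ cong₂ _+_ (childSum-cong p v λ c _ → D-old-new c)
                   (trans (cong (δ v w *_) D-new-new) (*-identityʳ (δ v w))) ⟨
    childSum p (λ c → D (inject₁ c) (fromℕ n)) v + δ v w * D (fromℕ n) (fromℕ n)
      ≡⟨ cong₂ _+_ (δ-off (inject₁ v) (fromℕ n) (Finₚ.fromℕ≢inject₁ ∘ sym))
                   (childSum-attach-inject₁ p w (λ c → D c (fromℕ n)) v) ⟨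
    δ (inject₁ v) (fromℕ n) + childSum (attach p w) (λ c → D c (fromℕ n)) (inject₁ v) ∎
  ... | ‵fromℕ     | ‵inject₁ u = begin
    D (fromℕ n) (inject₁ u)                             ≡⟨ D-new-old u ⟩
    0
      ≡⟨ cong₂ _+_ (δ-off (fromℕ n) (inject₁ u) Finₚ.fromℕ≢inject₁)
                   (childSum-attach-fromℕ p w (λ c → D c (inject₁ u))) ⟨
    δ (fromℕ n) (inject₁ u) + childSum (attach p w) (λ c → D c (inject₁ u)) (fromℕ n) ∎
  ... | ‵fromℕ     | ‵fromℕ     = begin
    D (fromℕ n) (fromℕ n)                               ≡⟨ D-new-new ⟩
    1
      ≡⟨ cong₂ _+_ (cong 𝟙 (dec-true (fromℕ n Finₚ.≟ fromℕ n) refl))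
                   (childSum-attach-fromℕ p w (λ c → D c (fromℕ n))) ⟨
    δ (fromℕ n) (fromℕ n) + childSum (attach p w) (λ c → D c (fromℕ n)) (fromℕ n) ∎

-- The matrix follows the construction of the tree by attachments, so the induction runs over
-- membership in the enumeration.
descendants : ∀ m {p} → p ∈ recursiveTreeList (suc m) → Descendants p
descendants zero (here refl) = record
  { descendant        = λ _ _ → 1
  ; descendant≤1      = λ _ _ → ≤-refl
  ; descendant-unfold = λ { zero zero → refl }
  }
descendants (suc m) p∈
  with ∈-cartesianProductWith⁻ attach (recursiveTreeList (suc m)) (allFin (suc m)) p∈
... | q , w , q∈ , _ , refl = descendants-attach (descendants m q∈) w

-- Effect of one attachment on the number of big fringe subtrees

≤?-split : ∀ j x → 𝟙 (does (j ≤? x)) ≡ 𝟙 (does (suc j ≤? x)) + 𝟙 (does (x ≟ j))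
≤?-split zero    zero    = refl
≤?-split zero    (suc x) = refl
≤?-split (suc j) zero    = refl
≤?-split (suc j) (suc x) = begin
  𝟙 (does (suc j ≤? suc x))
    ≡⟨ cong 𝟙 (does-⇔ (mk⇔ s≤s⁻¹ s≤s) (suc j ≤? suc x) (j ≤? x)) ⟩
  𝟙 (does (j ≤? x))                                      ≡⟨ ≤?-split j x ⟩
  𝟙 (does (suc j ≤? x)) + 𝟙 (does (x ≟ j))
    ≡⟨ cong₂ _+_ (cong 𝟙 (does-⇔ (mk⇔ s≤s⁻¹ s≤s) (suc (suc j) ≤? suc x) (suc j ≤? x)))
                 (cong 𝟙 (does-⇔ (mk⇔ suc-injective (cong suc)) (suc x ≟ suc j) (x ≟ j))) ⟨
  𝟙 (does (suc (suc j) ≤? suc x)) + 𝟙 (does (suc x ≟ suc j)) ∎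
  where open ≡-Reasoning

-- An increment of at most one crosses the threshold j + 1 only when it starts from exactly j.
≤?-grow : ∀ j x {a} → a ≤ 1 →
  𝟙 (does (suc j ≤? x + a)) ≡ 𝟙 (does (suc j ≤? x)) + a * 𝟙 (does (x ≟ j))
≤?-grow j x {0} _ = trans (cong (λ y → 𝟙 (does (suc j ≤? y))) (+-identityʳ x)) (sym (+-identityʳ _))
≤?-grow j x {1} _ = begin
  𝟙 (does (suc j ≤? x + 1))                     ≡⟨ cong (λ y → 𝟙 (does (suc j ≤? y))) (+-comm x 1) ⟩
  𝟙 (does (suc j ≤? suc x))
    ≡⟨ cong 𝟙 (does-⇔ (mk⇔ s≤s⁻¹ s≤s) (suc j ≤? suc x) (j ≤? x)) ⟩
  𝟙 (does (j ≤? x))                             ≡⟨ ≤?-split j x ⟩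
  𝟙 (does (suc j ≤? x)) + 𝟙 (does (x ≟ j))
    ≡⟨ cong (𝟙 (does (suc j ≤? x)) +_) (*-identityˡ (𝟙 (does (x ≟ j)))) ⟨
  𝟙 (does (suc j ≤? x)) + 1 * 𝟙 (does (x ≟ j))  ∎
  where open ≡-Reasoning
≤?-grow j x {suc (suc a)} (s≤s ())

*-𝟙-≡ : ∀ {x j} (x≟j : Dec (x ≡ j)) → x * 𝟙 (does x≟j) ≡ j * 𝟙 (does x≟j)
*-𝟙-≡         (yes refl) = refl
*-𝟙-≡ {x} {j} (no  _)    = trans (*-zeroʳ x) (sym (*-zeroʳ j))

fringesOfSize : ParentMap n → ℕ → ℕ
fringesOfSize {n} p j = ∑[ v < n ] 𝟙 (does (fringeSize p v ≟ j))

bigFringes-split : ∀ (p : ParentMap n) j → bigFringes p j ≡ bigFringes p (suc j) + fringesOfSize p j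
bigFringes-split p j = trans (sum-cong-≗ λ v → ≤?-split j (fringeSize p v))
  (∑-distrib-+ (λ v → 𝟙 (does (suc j ≤? fringeSize p v))) _)

module _ {p : ParentMap n} (rec : IsRecursiveTree p)
  (rec′ : ∀ w → IsRecursiveTree (attach p w)) (desc : Descendants p) where

  open Descendants desc

  -- Both sides solve f v = 1 + `childSum p f v`: summing the unfolding of `descendant` over u turns
  -- the `δ` term into 1.
  fringeSize-descendants : ∀ v → fringeSize p v ≡ ∑[ u < n ] descendant v u
  fringeSize-descendants = childSum-unique rec (λ _ → 1) (fringeSize-unfold rec) λ v → begin
    ∑[ u < n ] descendant v u  ≡⟨ sum-cong-≗ (descendant-unfold v) ⟩
    ∑[ u < n ] (δ v u + childSum p (λ c → descendant c u) v)  ≡⟨ ∑-distrib-+ (δ v) _ ⟩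
    ∑[ u < n ] δ v u + ∑[ u < n ] childSum p (λ c → descendant c u) v
      ≡⟨ cong₂ _+_ (sum-δ v) (childSum-sum p descendant v) ⟩
    1 + childSum p (λ c → ∑[ u < n ] descendant c u) v ∎
    where open ≡-Reasoning

  fringeSize-attach-fromℕ : ∀ w → fringeSize (attach p w) (fromℕ n) ≡ 1
  fringeSize-attach-fromℕ w = trans (fringeSize-unfold (rec′ w) (fromℕ n))
    (cong suc (childSum-attach-fromℕ p w (fringeSize (attach p w))))

  -- Both sides, as functions of v, solve f v = 1 + `δ v w` + `childSum p f v`. On the left the
  -- summand `δ v w` is the new leaf of size 1 below `w`; on the right it is the diagonal term of
  -- `descendant`.
  fringeSize-attach-inject₁ : ∀ w v →
    fringeSize (attach p w) (inject₁ v) ≡ fringeSize p v + descendant v w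
  fringeSize-attach-inject₁ w = childSum-unique rec (λ v → 1 + δ v w)
    (λ v → begin
      s′ (inject₁ v)
        ≡⟨ fringeSize-unfold (rec′ w) (inject₁ v) ⟩
      1 + childSum (attach p w) s′ (inject₁ v)
        ≡⟨ cong suc (childSum-attach-inject₁ p w s′ v) ⟩
      1 + (childSum p (s′ ∘ inject₁) v + δ v w * s′ (fromℕ n))
        ≡⟨ cong (λ x → 1 + (childSum p (s′ ∘ inject₁) v + δ v w * x)) (fringeSize-attach-fromℕ w) ⟩
      1 + (childSum p (s′ ∘ inject₁) v + δ v w * 1)
        ≡⟨ rearrange₁ (childSum p (s′ ∘ inject₁) v) (δ v w) ⟩
      1 + δ v w + childSum p (s′ ∘ inject₁) v               ∎)
    (λ v → begin
      fringeSize p v + descendant v w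
        ≡⟨ cong₂ _+_ (fringeSize-unfold rec v) (descendant-unfold v w) ⟩
      1 + childSum p (fringeSize p) v + (δ v w + childSum p (λ c → descendant c w) v)
        ≡⟨ rearrange₂ (childSum p (fringeSize p) v) (δ v w) _ ⟩
      1 + δ v w + (childSum p (fringeSize p) v + childSum p (λ c → descendant c w) v)
        ≡⟨ cong (1 + δ v w +_) (childSum-+ p (fringeSize p) (λ c → descendant c w) v) ⟨
      1 + δ v w + childSum p (λ c → fringeSize p c + descendant c w) v ∎)
    where
    open ≡-Reasoning
    s′ = fringeSize (attach p w)

    rearrange₁ : ∀ x d → 1 + (x + d * 1) ≡ 1 + d + x
    rearrange₁ = solve-∀

    rearrange₂ : ∀ x d y → 1 + x + (d + y) ≡ 1 + d + (x + y)
    rearrange₂ = solve-∀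

  -- With j = `suc i` the threshold `suc j` is at least 2, so the new leaf never counts as big and
  -- contributes the final 0.
  bigFringes-attach : ∀ w i → let j = suc i in
    bigFringes (attach p w) (suc j) ≡
    ∑[ v < n ] (𝟙 (does (suc j ≤? fringeSize p v)) + descendant v w * 𝟙 (does (fringeSize p v ≟ j)))
  bigFringes-attach w i = begin
    bigFringes (attach p w) (suc j)          ≡⟨ sum-init-last (λ v → 𝟙 (does (suc j ≤? s′ v))) ⟩
    ∑[ v < n ] 𝟙 (does (suc j ≤? s′ (inject₁ v))) + 𝟙 (does (suc j ≤? s′ (fromℕ n)))
      ≡⟨ cong₂ _+_ (sum-cong-≗ λ v → trans
                     (cong (λ x → 𝟙 (does (suc j ≤? x))) (fringeSize-attach-inject₁ w v))
                     (≤?-grow j (fringeSize p v) (descendant≤1 v w)))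
                   (cong (λ x → 𝟙 (does (suc j ≤? x))) (fringeSize-attach-fromℕ w)) ⟩
    ∑[ v < n ] (𝟙 (does (suc j ≤? fringeSize p v)) + descendant v w * 𝟙 (does (fringeSize p v ≟ j))) + 0
      ≡⟨ +-identityʳ _ ⟩
    ∑[ v < n ] (𝟙 (does (suc j ≤? fringeSize p v)) + descendant v w * 𝟙 (does (fringeSize p v ≟ j))) ∎
    where
    open ≡-Reasoning
    j = suc i
    s′ = fringeSize (attach p w)

  -- A subtree that is already big stays big for all n choices of `w`. One of size exactly j becomes
  -- big for the j choices of `w` inside it.
  sum-bigFringes-attach : ∀ i → let j = suc i in
    ∑[ w < n ] bigFringes (attach p w) (suc j) ≡ n * bigFringes p (suc j) + j * fringesOfSize p j
  sum-bigFringes-attach i = begin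
    ∑[ w < n ] bigFringes (attach p w) (suc j)
      ≡⟨ sum-cong-≗ (λ w → bigFringes-attach w i) ⟩
    ∑[ w < n ] ∑[ v < n ] (big v + descendant v w * exact v)
      ≡⟨ ∑-comm (λ w v → big v + descendant v w * exact v) ⟩
    ∑[ v < n ] ∑[ w < n ] (big v + descendant v w * exact v)          ≡⟨ sum-cong-≗ over-w ⟩
    ∑[ v < n ] (n * big v + j * exact v)
      ≡⟨ ∑-distrib-+ (λ v → n * big v) _ ⟩
    ∑[ v < n ] (n * big v) + ∑[ v < n ] (j * exact v)
      ≡⟨ cong₂ _+_ (*-distribˡ-sum n big) (*-distribˡ-sum j exact) ⟨
    n * bigFringes p (suc j) + j * fringesOfSize p j                  ∎
    where
    open ≡-Reasoning
    j = suc i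
    big exact : Fin n → ℕ
    big   v = 𝟙 (does (suc j ≤? fringeSize p v))
    exact v = 𝟙 (does (fringeSize p v ≟ j))

    over-w : ∀ v → ∑[ w < n ] (big v + descendant v w * exact v) ≡ n * big v + j * exact v
    over-w v = begin
      ∑[ w < n ] (big v + descendant v w * exact v)
        ≡⟨ ∑-distrib-+ (λ _ → big v) (λ w → descendant v w * exact v) ⟩
      ∑[ w < n ] big v + ∑[ w < n ] (descendant v w * exact v)
        ≡⟨ cong₂ _+_ (sum-const n (big v)) (sym (*-distribʳ-sum (exact v) (descendant v))) ⟩
      n * big v + (∑[ w < n ] descendant v w) * exact v
        ≡⟨ cong (λ x → n * big v + x * exact v) (fringeSize-descendants v) ⟨
      -- The indicator `exact v` vanishes unless the size is j, so the size in front of it may be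
      -- replaced by j.
      n * big v + fringeSize p v * exact v
        ≡⟨ cong (n * big v +_) (*-𝟙-≡ (fringeSize p v ≟ j)) ⟩
      n * big v + j * exact v                                   ∎

-- Totals over all recursive trees of a given size

total : ∀ n → (ParentMap n → ℕ) → ℕ
total n f = sumₗ (List.map f (recursiveTreeList n))

sum-map-cong : ∀ {f g : X → ℕ} xs → (∀ {x} → x ∈ xs → f x ≡ g x) →
  sumₗ (List.map f xs) ≡ sumₗ (List.map g xs)
sum-map-cong []       f≗g = refl
sum-map-cong (x ∷ xs) f≗g = cong₂ _+_ (f≗g (here refl)) (sum-map-cong xs (f≗g ∘ there))

sum-map-mono : ∀ {f g : X → ℕ} xs → (∀ x → f x ≤ g x) → sumₗ (List.map f xs) ≤ sumₗ (List.map g xs)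
sum-map-mono []       f≤g = z≤n
sum-map-mono (x ∷ xs) f≤g = +-mono-≤ (f≤g x) (sum-map-mono xs f≤g)

sum-map-+ : ∀ (f g : X → ℕ) xs →
  sumₗ (List.map (λ x → f x + g x) xs) ≡ sumₗ (List.map f xs) + sumₗ (List.map g xs)
sum-map-+ f g []       = refl
sum-map-+ f g (x ∷ xs) = trans (cong (f x + g x +_) (sum-map-+ f g xs)) (+-+-swap (f x) (g x) _ _)
  where
  +-+-swap : ∀ a b c d → a + b + (c + d) ≡ a + c + (b + d)
  +-+-swap = solve-∀

sum-map-* : ∀ m (f : X → ℕ) xs → sumₗ (List.map (λ x → m * f x) xs) ≡ m * sumₗ (List.map f xs)
sum-map-* m f []       = sym (*-zeroʳ m)
sum-map-* m f (x ∷ xs) = trans (cong (m * f x +_) (sum-map-* m f xs)) (sym (*-distribˡ-+ m (f x) _))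

sum-map-const : ∀ m (xs : List X) → sumₗ (List.map (λ _ → m) xs) ≡ length xs * m
sum-map-const m []       = refl
sum-map-const m (x ∷ xs) = cong (m +_) (sum-map-const m xs)

sum-map-tabulate : ∀ (f : Fin n → X) (g : X → ℕ) →
  sumₗ (List.map g (List.tabulate f)) ≡ ∑[ i < n ] g (f i)
sum-map-tabulate {zero}  f g = refl
sum-map-tabulate {suc n} f g = cong (g (f zero) +_) (sum-map-tabulate (f ∘ suc) g)

sum-map-cartesianProductWith : ∀ {A B C : Set} (h : A → B → C) (f : C → ℕ) xs ys →
  sumₗ (List.map f (cartesianProductWith h xs ys)) ≡ sumₗ (List.map (λ x → sumₗ (List.map (f ∘ h x) ys)) xs)
sum-map-cartesianProductWith h f []       ys = refl
sum-map-cartesianProductWith h f (x ∷ xs) ys = begin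
  sumₗ (List.map f (List.map (h x) ys ++ rest))
    ≡⟨ cong sumₗ (Listₚ.map-++ f (List.map (h x) ys) rest) ⟩
  sumₗ (List.map f (List.map (h x) ys) ++ List.map f rest)
    ≡⟨ ListActionₚ.sum-++ (List.map f (List.map (h x) ys)) _ ⟩
  sumₗ (List.map f (List.map (h x) ys)) + sumₗ (List.map f rest)
    ≡⟨ cong₂ _+_ (cong sumₗ (sym (Listₚ.map-∘ ys))) (sum-map-cartesianProductWith h f xs ys) ⟩
  sumₗ (List.map (f ∘ h x) ys) + sumₗ (List.map (λ x → sumₗ (List.map (f ∘ h x) ys)) xs) ∎
  where
  open ≡-Reasoning
  rest = cartesianProductWith h xs ys

total-attach : ∀ m f → total (suc (suc m)) f ≡ total (suc m) (λ p → ∑[ w < suc m ] f (attach p w))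
total-attach m f = trans
  (sum-map-cartesianProductWith attach f (recursiveTreeList (suc m)) (allFin (suc m)))
  (sum-map-cong (recursiveTreeList (suc m)) λ {p} _ → sum-map-tabulate id (f ∘ attach p))

total-bigFringes-step : ∀ m i → let j = suc i; N = suc m in
  total (suc N) (λ p → bigFringes p (suc j)) ≡
  N * total N (λ p → bigFringes p (suc j)) + j * total N (λ p → fringesOfSize p j)
total-bigFringes-step m i = begin
  total (suc N) (λ p → bigFringes p (suc j)) ≡⟨ total-attach m (λ p → bigFringes p (suc j)) ⟩
  total N (λ p → ∑[ w < N ] bigFringes (attach p w) (suc j))
    ≡⟨ sum-map-cong (recursiveTreeList N) (λ p∈ →
         sum-bigFringes-attach (rec p∈) (rec′ p∈) (descendants m p∈) i) ⟩
  total N (λ p → N * bigFringes p (suc j) + j * fringesOfSize p j)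
    ≡⟨ sum-map-+ (λ p → N * bigFringes p (suc j)) _ (recursiveTreeList N) ⟩
  total N (λ p → N * bigFringes p (suc j)) + total N (λ p → j * fringesOfSize p j)
    ≡⟨ cong₂ _+_ (sum-map-* N (λ p → bigFringes p (suc j)) (recursiveTreeList N))
                 (sum-map-* j (λ p → fringesOfSize p j) (recursiveTreeList N)) ⟩
  N * total N (λ p → bigFringes p (suc j)) + j * total N (λ p → fringesOfSize p j) ∎
  where
  open ≡-Reasoning
  j = suc i
  N = suc m

  rec : ∀ {p} → p ∈ recursiveTreeList N → IsRecursiveTree p
  rec = Enumeration.sound (recursiveTrees N)

  -- `attach p w` occurs in the enumeration for the next size, so soundness of that enumeration
  -- applies.
  rec′ : ∀ {p} → p ∈ recursiveTreeList N → ∀ w → IsRecursiveTree (attach p w)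
  rec′ p∈ w = Enumeration.sound (recursiveTrees (suc N))
    (∈-cartesianProductWith⁺ attach p∈ (∈-allFin w))

total-bigFringes-split : ∀ n j →
  total n (λ p → bigFringes p j) ≡
  total n (λ p → bigFringes p (suc j)) + total n (λ p → fringesOfSize p j)
total-bigFringes-split n j = trans
  (sum-map-cong (recursiveTreeList n) λ {p} _ → bigFringes-split p j)
  (sum-map-+ (λ p → bigFringes p (suc j)) _ (recursiveTreeList n))

-- This is the bound n / k multiplied by k and by the number of trees. Threshold 1 is bounded by the
-- number of nodes. In the step, with `d` = N - j, the recurrence is regrouped so that the totals
-- for the thresholds j + 1 and j at size N appear with the nonnegative weights `d` and j. The two
-- hypotheses then add up to (d + j + 1) N ! = (N + 1) N !.
total-bigFringes-bound : ∀ {i m} → i ≤ m →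
  suc i * total (suc m) (λ p → bigFringes p (suc i)) ≤ suc m !
total-bigFringes-bound {zero} {m} _ = begin
  1 * total N (λ p → bigFringes p 1)        ≡⟨ *-identityˡ _ ⟩
  total N (λ p → bigFringes p 1)
    ≤⟨ sum-map-mono (recursiveTreeList N) (λ p → sum-const-≤ λ v → 𝟙≤1 (does (1 ≤? fringeSize p v))) ⟩
  total N (λ _ → N * 1)                     ≡⟨ sum-map-const (N * 1) (recursiveTreeList N) ⟩
  length (recursiveTreeList N) * (N * 1)
    ≡⟨ cong₂ _*_ (length-recursiveTreeList m) (*-identityʳ N) ⟩
  m ! * N                                   ≡⟨ *-comm (m !) N ⟩
  N !                                       ∎
  where
  open ≤-Reasoning
  N = suc m
total-bigFringes-bound {suc i} {suc m} (s≤s i≤m) = begin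
  suc j * total (suc N) (λ p → bigFringes p (suc j))
    ≡⟨ cong (suc j *_) (total-bigFringes-step m i) ⟩
  suc j * (N * big + j * exact)
    ≡⟨ cong (λ N → suc j * (N * big + j * exact)) n≡d+j ⟩
  suc j * ((d + j) * big + j * exact)                    ≡⟨ regroup j d big exact ⟩
  d * (suc j * big) + suc j * (j * (big + exact))
    ≤⟨ +-mono-≤ (excess (m≤n⇒m<n∨m≡n i≤m)) (*-monoʳ-≤ (suc j) big-j) ⟩
  d * N ! + suc j * N !                                  ≡⟨ *-distribʳ-+ (N !) d (suc j) ⟨
  (d + suc j) * N !
    ≡⟨ cong (_* N !) (trans (+-suc d j) (cong suc (sym n≡d+j))) ⟩
  suc N * N !                                            ∎
  where
  open ≤-Reasoning
  j = suc i
  N = suc m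
  d = m ∸ i
  big   = total N (λ p → bigFringes p (suc j))
  exact = total N (λ p → fringesOfSize p j)

  n≡d+j : N ≡ d + j
  n≡d+j = trans (cong suc (sym (m∸n+n≡m i≤m))) (sym (+-suc d i))

  regroup : ∀ j d x y → suc j * ((d + j) * x + j * y) ≡ d * (suc j * x) + suc j * (j * (x + y))
  regroup = solve-∀

  big-j : j * (big + exact) ≤ N !
  big-j = ≤-trans (≤-reflexive (cong (j *_) (sym (total-bigFringes-split N j))))
                  (total-bigFringes-bound i≤m)

  -- The induction hypothesis for threshold j + 1 requires j < N. In the boundary case j = N the
  -- weight `d` is zero, so no bound on `big` is called for.
  excess : i < m ⊎ i ≡ m → d * (suc j * big) ≤ d * N !
  excess (inj₁ i<m) = *-monoʳ-≤ d (total-bigFringes-bound i<m)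
  excess (inj₂ i≡m) = ≤-reflexive (trans (cong (_* (suc j * big)) d≡0) (cong (_* N !) (sym d≡0)))
    where
    d≡0 : d ≡ 0
    d≡0 = trans (cong (m ∸_) i≡m) (n∸n≡0 m)

total-compactedSize-bound : ∀ {i m} → i ≤ m →
  suc i * total (suc m) compactedSize ≤ suc m ! + m ! * (suc i * 4 ^ suc i)
total-compactedSize-bound {i} {m} i≤m = begin
  k * total N compactedSize
    ≤⟨ *-monoʳ-≤ k (sum-map-mono (recursiveTreeList N) (λ p → compactedSize-bound p k)) ⟩
  k * total N (λ p → bigFringes p k + 4 ^ k)
    ≡⟨ cong (k *_) (sum-map-+ (λ p → bigFringes p k) (λ _ → 4 ^ k) (recursiveTreeList N)) ⟩
  k * (total N (λ p → bigFringes p k) + total N (λ _ → 4 ^ k))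
    ≡⟨ cong (λ x → k * (total N (λ p → bigFringes p k) + x)) (sum-map-const (4 ^ k) (recursiveTreeList N)) ⟩
  k * (total N (λ p → bigFringes p k) + length (recursiveTreeList N) * 4 ^ k)
    ≡⟨ cong (λ x → k * (total N (λ p → bigFringes p k) + x * 4 ^ k)) (length-recursiveTreeList m) ⟩
  k * (total N (λ p → bigFringes p k) + m ! * 4 ^ k)              ≡⟨ regroup k _ (m !) (4 ^ k) ⟩
  k * total N (λ p → bigFringes p k) + m ! * (k * 4 ^ k)
    ≤⟨ +-monoˡ-≤ _ (total-bigFringes-bound i≤m) ⟩
  N ! + m ! * (k * 4 ^ k)                                         ∎
  where
  open ≤-Reasoning
  k = suc i
  N = suc m

  regroup : ∀ k x l y → k * (x + l * y) ≡ k * x + l * (k * y)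
  regroup = solve-∀

-- Rational bounds

open ℤ using (+_)

/-mono : ∀ {a b} c d .{{_ : NonZero c}} .{{_ : NonZero d}} → a * d ≤ b * c → + a ℚ./ c ℚ.≤ + b ℚ./ d
/-mono {a} {b} (suc c) (suc d) ad≤bc = *≤*
  (subst₂ ℤ._≤_ (ℤₚ.pos-* a (suc d)) (ℤₚ.pos-* b (suc c)) (ℤ.+≤+ ad≤bc))

/-cancel : ∀ {a b c d} .{{_ : NonZero c}} .{{_ : NonZero d}} → + a ℚ./ c ℚ.≤ + b ℚ./ d → a * d ≤ b * c
/-cancel {a} {b} {suc c} {suc d} (*≤* le) =
  ℤₚ.drop‿+≤+ (subst₂ ℤ._≤_ (sym (ℤₚ.pos-* a (suc d))) (sym (ℤₚ.pos-* b (suc c))) le)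

/-* : ∀ a b c d .{{_ : NonZero c}} .{{_ : NonZero d}} → let instance _ = m*n≢0 c d in
  (+ a ℚ./ c) ℚ.* (+ b ℚ./ d) ≡ + (a * b) ℚ./ (c * d)
/-* a b (suc c) (suc d) = cong (ℚ._/ (suc c * suc d)) (sym (ℤₚ.pos-* a b))

/-nonNeg : ∀ a c .{{_ : NonZero c}} → ℚ.NonNegative (+ a ℚ./ c)
/-nonNeg a (suc c) = _

expTerm-nonNeg : ∀ k {q} .{{_ : ℚ.NonNegative q}} → ℚ.NonNegative (expTerm k q)
expTerm-nonNeg zero    = _
expTerm-nonNeg (suc k) {q} =
  ℚₚ.nonNeg*nonNeg⇒nonNeg (expTerm k q ℚ.* q)
    {{ℚₚ.nonNeg*nonNeg⇒nonNeg (expTerm k q) {{expTerm-nonNeg k}} q}} (+ 1 ℚ./ suc k)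

expSum-nonNeg : ∀ k {q} .{{_ : ℚ.NonNegative q}} → ℚ.NonNegative (expSum k q)
expSum-nonNeg zero    = _
expSum-nonNeg (suc k) {q} =
  ℚₚ.nonNeg+nonNeg⇒nonNeg (expSum k q) {{expSum-nonNeg k}} (expTerm (suc k) q) {{expTerm-nonNeg (suc k)}}

expTerm≤expSum : ∀ k {q} .{{_ : ℚ.NonNegative q}} → expTerm k q ℚ.≤ expSum k q
expTerm≤expSum zero        = ℚₚ.≤-refl
expTerm≤expSum (suc k) {q} = ℚₚ.p≤q+p (expTerm (suc k) q) (expSum k q) {{expSum-nonNeg k}}

-- Passing from term j to term j + 1 multiplies by q / (j + 1), which is at least c as long as q ≥ c
-- m and j + 1 ≤ m.
expTerm-lower : ∀ {c m q} → + (c * m) ℚ./ 1 ℚ.≤ q → ∀ j → j ≤ m → + (c ^ j) ℚ./ 1 ℚ.≤ expTerm j q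
expTerm-lower cm≤q zero    _   = ℚₚ.≤-refl
expTerm-lower {c} {m} {q} cm≤q (suc j) j<m = begin
  + (c ^ suc j) ℚ./ 1                                            ≤⟨ /-mono 1 (1 * 1 * suc j) ineq ⟩
  + (c ^ j * (c * m) * 1) ℚ./ (1 * 1 * suc j)
    ≡⟨ /-* (c ^ j * (c * m)) 1 (1 * 1) (suc j) ⟨
  (+ (c ^ j * (c * m)) ℚ./ (1 * 1)) ℚ.* (+ 1 ℚ./ suc j)
    ≡⟨ cong (ℚ._* (+ 1 ℚ./ suc j)) (/-* (c ^ j) (c * m) 1 1) ⟨
  (+ (c ^ j) ℚ./ 1) ℚ.* (+ (c * m) ℚ./ 1) ℚ.* (+ 1 ℚ./ suc j)
    ≤⟨ ℚₚ.*-monoˡ-≤-nonNeg (+ 1 ℚ./ suc j)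
         (ℚₚ.*-mono-≤-nonNeg {{/-nonNeg (c ^ j) 1}} {{/-nonNeg (c * m) 1}}
           (expTerm-lower cm≤q j (<⇒≤ j<m)) cm≤q) ⟩
  expTerm j q ℚ.* q ℚ.* (+ 1 ℚ./ suc j)                          ∎
  where
  open ℚₚ.≤-Reasoning

  regroup₁ : ∀ c x j → c * x * (1 * 1 * suc j) ≡ x * c * suc j
  regroup₁ = solve-∀

  regroup₂ : ∀ c x m → x * c * m ≡ x * (c * m) * 1 * 1
  regroup₂ = solve-∀

  ineq : c ^ suc j * (1 * 1 * suc j) ≤ c ^ j * (c * m) * 1 * 1
  ineq = subst₂ _≤_ (sym (regroup₁ c (c ^ j) j)) (regroup₂ c (c ^ j) m) (*-monoʳ-≤ (c ^ j * c) j<m)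

-- The term of index m of exp (c * m) is already at least c ^ m, as m ! ≤ m ^ m.
≤ln-upper : ∀ {c m n q} → q ≤ln n → n < c ^ m → q ℚ.≤ + (c * m) ℚ./ 1
≤ln-upper {c} {m} {n} {q} (0≤q , sums≤n) n<c^m with ℚₚ.≤-total q (+ (c * m) ℚ./ 1)
... | inj₁ q≤cm = q≤cm
... | inj₂ cm≤q = contradiction
  (subst₂ _≤_ (*-identityʳ (c ^ m)) (*-identityʳ n) (/-cancel c^m≤n)) (<⇒≱ n<c^m)
  where
  c^m≤n : + (c ^ m) ℚ./ 1 ℚ.≤ + n ℚ./ 1
  c^m≤n = ℚₚ.≤-trans (expTerm-lower {c} {m} cm≤q m ≤-refl)
    (ℚₚ.≤-trans (expTerm≤expSum m {{ℚ.nonNegative 0≤q}}) (sums≤n m))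

-- Choice of the threshold and the final estimate

log₈-floor : ∀ n → ∃ λ k → 8 ^ k ≤ suc n × suc n < 8 ^ suc k
log₈-floor zero = 0 , s≤s z≤n , s≤s (s≤s z≤n)
log₈-floor (suc n) with log₈-floor n
... | k , lower , upper with suc (suc n) <? 8 ^ suc k
...   | yes upper′ = k , m≤n⇒m≤1+n lower , upper′
...   | no  ≮      = suc k , ≮⇒≥ ≮ , ≤-<-trans upper (^-monoʳ-< 8 (s≤s (s≤s z≤n)) (n<1+n (suc k)))

-- This is the reason for base 8: doubling the growth rate 4 of the shapes leaves a factor 2 ^ k
-- that absorbs k.
k*4^k≤8^k : ∀ k → k * 4 ^ k ≤ 8 ^ k
k*4^k≤8^k zero    = z≤n
k*4^k≤8^k (suc k) = begin
  suc k * (4 * 4 ^ k)             ≡⟨ regroup k (4 ^ k) ⟩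
  4 * (k * 4 ^ k) + 4 * 4 ^ k
    ≤⟨ +-mono-≤ (*-monoʳ-≤ 4 (k*4^k≤8^k k)) (*-monoʳ-≤ 4 (^-monoˡ-≤ k (s≤s (s≤s (s≤s (s≤s z≤n)))))) ⟩
  4 * 8 ^ k + 4 * 8 ^ k           ≡⟨ *-distribʳ-+ (8 ^ k) 4 4 ⟨
  8 * 8 ^ k                       ∎
  where
  open ≤-Reasoning
  regroup : ∀ k x → suc k * (4 * x) ≡ 4 * (k * x) + 4 * x
  regroup = solve-∀

-- The threshold k cancels between the mean, at most 2 n / k, and the logarithm, at most 16 k. This
-- leaves the constant 32 = 2 * 16.
mean-bound : ∀ {T k n q} L .{{_ : NonZero L}} → k * T ≤ L * (2 * n) → q ℚ.≤ + (16 * k) ℚ./ 1 →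
  (+ T ℚ./ L) ℚ.* q ℚ.≤ (+ 32 ℚ./ 1) ℚ.* (+ n ℚ./ 1)
mean-bound {T} {k} {n} {q} L kT≤2nL q≤16k = begin
  (+ T ℚ./ L) ℚ.* q
    ≤⟨ ℚₚ.*-monoʳ-≤-nonNeg (+ T ℚ./ L) {{/-nonNeg T L}} q≤16k ⟩
  (+ T ℚ./ L) ℚ.* (+ (16 * k) ℚ./ 1)      ≡⟨ /-* T (16 * k) L 1 ⟩
  + (T * (16 * k)) ℚ./ (L * 1)
    ≤⟨ /-mono (L * 1) 1 (subst₂ _≤_ (regroup₁ k T) (regroup₂ L n) (*-monoʳ-≤ 16 kT≤2nL)) ⟩
  + (32 * n) ℚ./ 1                        ≡⟨ /-* 32 n 1 1 ⟨
  (+ 32 ℚ./ 1) ℚ.* (+ n ℚ./ 1)            ∎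
  where
  open ℚₚ.≤-Reasoning
  instance _ = m*n≢0 L 1

  regroup₁ : ∀ k T → 16 * (k * T) ≡ T * (16 * k) * 1
  regroup₁ = solve-∀

  regroup₂ : ∀ L n → 16 * (L * (2 * n)) ≡ 32 * n * (L * 1)
  regroup₂ = solve-∀

theorem2p8 : ∃ λ (C : ℚᵘ) → ∃ λ (N : ℕ) → (∀ (n : ℕ) .{{_ : NonZero n}} → N ≤ n →
    ∀ (q : ℚᵘ) → q ≤ln n → 𝔼[X n ] ℚ.* q ℚ.≤ C ℚ.* (+ n ℚ./ 1))
theorem2p8 = + 32 ℚ./ 1 , 8 , λ { n@(suc m) 8≤n q q≤ln → bound m 8≤n q q≤ln }
  where
  bound : ∀ m → 8 ≤ suc m → ∀ q → q ≤ln suc m →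
    𝔼[X suc m ] ℚ.* q ℚ.≤ (+ 32 ℚ./ 1) ℚ.* (+ suc m ℚ./ 1)
  bound m 8≤n q q≤ln with log₈-floor m
  -- The assumption n ≥ 8 excludes k = 0, for which the bound n / k is meaningless.
  ... | zero  , _    , n<8     = contradiction 8≤n (<⇒≱ n<8)
  ... | k@(suc i) , 8^k≤n , n<8^1+k =
    mean-bound {n = suc m} (length (elements (recursiveTrees (suc m))))
      {{recursiveTrees-nonempty (suc m)}} T-bound q≤16k
    where
    k4^k≤n : k * 4 ^ k ≤ suc m
    k4^k≤n = ≤-trans (k*4^k≤8^k k) 8^k≤n

    -- The count of big subtrees requires k ≤ n, which follows from k ≤ k * 4 ^ k ≤ n.
    i≤m : i ≤ m
    i≤m = s≤s⁻¹ (≤-trans (m≤m*n k (4 ^ k) {{m^n≢0 4 k}}) k4^k≤n)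

    T-bound : k * total (suc m) compactedSize ≤ length (elements (recursiveTrees (suc m))) * (2 * suc m)
    T-bound = begin
      k * total (suc m) compactedSize   ≤⟨ total-compactedSize-bound i≤m ⟩
      suc m ! + m ! * (k * 4 ^ k)       ≤⟨ +-monoʳ-≤ (suc m !) (*-monoʳ-≤ (m !) k4^k≤n) ⟩
      suc m ! + m ! * suc m             ≡⟨ regroup (m !) (suc m) ⟩
      m ! * (2 * suc m)                 ≡⟨ cong (_* (2 * suc m)) (length-recursiveTreeList m) ⟨
      length (elements (recursiveTrees (suc m))) * (2 * suc m) ∎
      where
      open ≤-Reasoning
      regroup : ∀ l n → n * l + l * n ≡ l * (2 * n)
      regroup = solve-∀

    -- From n < 8 ^ (k + 1) comes q ≤ 8 (k + 1), with 8 as a crude bound for ln 8. Since k ≥ 1, the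
    -- extra 8 is at most 8 k.
    q≤16k : q ℚ.≤ + (16 * k) ℚ./ 1
    q≤16k = ℚₚ.≤-trans (≤ln-upper {8} {suc k} q≤ln n<8^1+k) (/-mono 1 1 (*-monoˡ-≤ 1 (begin
      8 * suc k     ≡⟨ *-suc 8 k ⟩
      8 + 8 * k     ≤⟨ +-monoˡ-≤ (8 * k) (m≤m*n 8 k) ⟩
      8 * k + 8 * k ≡⟨ *-distribʳ-+ k 8 8 ⟨
      16 * k        ∎)))
      where open ≤-Reasoning
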